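{- For every proposition $\phi$ of permissive-nominal logic, $\vDash_{fin}\phi$ if and only if $\vDash_{med}\phi$; that is, $\phi$ is valid in all interpretations with finite support (under all valuations) if and only if $\phi$ is valid in all interpretations with medium support (under all valuations).
   Context: **Atoms and permissive-nominal sets.** For each $i\in\mathbb N$ fix countably infinite sets of atoms $\mathbb A^<_i,\mathbb A^>_i$ (all these sets pairwise disjoint). Write $\mathbb A_i=\mathbb A^<_i\cup\mathbb A^>_i$, $\mathbb A^<=\bigcup_i\mathbb A^<_i$, $\mathbb A^>=\bigcup_i\mathbb A^>_i$, $\mathbb A=\mathbb A^<\cup\mathbb A^>$. A permutation is an element of the group $\mathbb P_{fin}$ of bijections of $\mathbb A$ generated by swappings $(a\ b)$ with $a,b$ in the same $\mathbb A_i$. For $A\subseteq\mathbb A$, $\pi\cdot A=\{\pi(a)\mid a\in A\}$. A permission set is a set of the form $\pi\cdot\mathbb A^<$. A set with a permutation action $\mathsf X$ is a carrier set $|\mathsf X|$ with a group action of $\mathbb P_{fin}$, written $\pi\cdot x$. $A\subseteq\mathbb A$ supports $x\in|\mathsf X|$ when every permutation $\pi$ with $\pi(a)=a$ for all $a\in A$ satisfies $\pi\cdot x=x$. $\mathsf X$ is a permissive-nominal set when every $x\in|\mathsf X|$ has a unique least supporting set $\mathrm{supp}(x)$ and this is contained in some permission set. A function $F:|\mathsf X|\to|\mathsf Y|$ is equivariant when $F(\pi\cdot x)=\pi\cdot F(x)$ for all $\pi,x$; a subset $U\subseteq|\mathsf X|$ is equivariant when $x\in U\Leftrightarrow\pi\cdot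 x\in U$ for all $x,\pi$. Atoms have action $\pi\cdot a=\pi(a)$; finite products have the componentwise action. For $a\in\mathbb A_\nu$, $x\in|\mathsf X|$, the abstraction is $[a]x=\{(a,x)\}\cup\{(b,(b\ a)\cdot x)\mid b\in\mathbb A_\nu\setminus\mathrm{supp}(x),\ b\neq a\}$; $[\mathbb A_\nu]\mathsf X$ has carrier $\{[a]x\mid a\in\mathbb A_\nu,x\in|\mathsf X|\}$ and action $\pi\cdot[a]x=[\pi(a)]\pi\cdot x$. **Signatures, terms, propositions.** A signature $\Sigma$ consists of: name sorts $\mathcal A\subseteq\mathbb N$ (ranged over by $\nu$) and base sorts $\mathcal B$ (ranged over by $\tau$), giving sorts $\alpha::=\nu\mid\tau\mid(\alpha,\dots,\alpha)\mid[\nu]\alpha$; constants $C$, each with a base sort $\mathrm{sort}(C)$ and a set $\mathrm{pmss}(C)\subseteq\mathbb A^<$; unknowns $X$, each with a sort $\mathrm{sort}(X)$; term-formers $\mathsf f$, each with an arity $(\alpha)\tau$; and proposition-formers $\mathsf P$, each with an arity $\alpha$. Terms: $a:\nu$ for $a\in\mathbb A_\nu$, $\nu\in\mathcal A$; $\pi\cdot C:\mathrm{sort}(C)$; $\pi\cdot X:\mathrm{sort}(X)$; $\mathsf f(r):\tau$ if $r:\alpha$ and $\mathsf f$ has arity $(\alpha)\tau$; $(r_1,\dots,r_n):(\alpha_1,\dots,\alpha_n)$ if $r_i:\alpha_i$; $[a]r:[\nu]\alpha$ if $a\in\mathbb A_\nu$, $\nu\in\mathcal A$, $r:\alpha$.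 Propositions of permissive-nominal logic (PNL): $\phi::=\bot\mid\phi\Rightarrow\phi\mid\forall X.\phi\mid\mathsf P(r)$, where $r:\alpha$ for $\alpha$ the arity of $\mathsf P$. **Interpretations.** An interpretation $\mathcal H$ assigns to each sort $\alpha$ a permissive-nominal set $[\![\alpha]\!]^{\mathcal H}$, together with: equivariant injective maps $\mathbb A_\nu\to[\![\nu]\!]^{\mathcal H}$, written $a^{\mathcal H}$; $[\mathbb A_\nu][\![\alpha]\!]^{\mathcal H}\to[\![[\nu]\alpha]\!]^{\mathcal H}$, written $[a]^{\mathcal H}x$; $\prod_i[\![\alpha_i]\!]^{\mathcal H}\to[\![(\alpha_1,\dots,\alpha_n)]\!]^{\mathcal H}$, written $(x_1,\dots,x_n)^{\mathcal H}$; an equivariant map $\mathsf f^{\mathcal H}:[\![\alpha]\!]^{\mathcal H}\to[\![\tau]\!]^{\mathcal H}$ for each $\mathsf f$ of arity $(\alpha)\tau$; $C^{\mathcal H}\in[\![\mathrm{sort}(C)]\!]^{\mathcal H}$ with $\mathrm{supp}(C^{\mathcal H})\subseteq\mathrm{pmss}(C)$ for each $C$; and an equivariant subset $\mathsf P^{\mathcal H}\subseteq[\![\alpha]\!]^{\mathcal H}$ for each $\mathsf P$ of arity $\alpha$. A valuation $\varsigma$ to $\mathcal H$ maps each unknown $X$ to some $\varsigma(X)\in[\![\mathrm{sort}(X)]\!]^{\mathcal H}$ with $\mathrm{supp}(\varsigma(X))\subseteq\mathbb A^<$; $\varsigma[X:=x]$ maps $X$ to $x$ and agrees with $\varsigma$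 elsewhere. Terms: $[\![a]\!]^{\mathcal H}_\varsigma=a^{\mathcal H}$, $[\![\pi\cdot C]\!]^{\mathcal H}_\varsigma=\pi\cdot C^{\mathcal H}$, $[\![\pi\cdot X]\!]^{\mathcal H}_\varsigma=\pi\cdot\varsigma(X)$, $[\![\mathsf f(r)]\!]^{\mathcal H}_\varsigma=\mathsf f^{\mathcal H}([\![r]\!]^{\mathcal H}_\varsigma)$, $[\![(r_1,\dots,r_n)]\!]^{\mathcal H}_\varsigma=([\![r_1]\!]^{\mathcal H}_\varsigma,\dots,[\![r_n]\!]^{\mathcal H}_\varsigma)^{\mathcal H}$, $[\![[a]r]\!]^{\mathcal H}_\varsigma=[a]^{\mathcal H}[\![r]\!]^{\mathcal H}_\varsigma$. Satisfaction $\mathcal H,\varsigma\vDash\phi$ is classical: $\bot$ is never satisfied; $\phi\Rightarrow\psi$ is satisfied iff $\phi$ is not or $\psi$ is; $\mathsf P(r)$ is satisfied iff $[\![r]\!]^{\mathcal H}_\varsigma\in\mathsf P^{\mathcal H}$; $\mathcal H,\varsigma\vDash\forall X.\phi$ iff $\mathcal H,\varsigma[X:=x]\vDash\phi$ for every $x\in[\![\mathrm{sort}(X)]\!]^{\mathcal H}$ with $\mathrm{supp}(x)\subseteq\mathbb A^<$. **Finite and medium support.** For each $i$ fix $\mathbb A^{\ll}_i\subseteq\mathbb A^<_i$ such that $\mathbb A^{\ll}_i$ and $\mathbb A^<_i\setminus\mathbb A^{\ll}_i$ are both infinite; $\mathbb A^{\ll}=\bigcup_i\mathbb A^{\ll}_i$.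 $\mathcal H$ has medium support when for every sort $\alpha$ and every $x\in[\![\alpha]\!]^{\mathcal H}$ there is a permutation $\pi$ with $\mathrm{supp}(x)\subseteq\pi\cdot\mathbb A^{\ll}$; $\mathcal H$ has finite support when every such $\mathrm{supp}(x)$ is finite. $\vDash_{med}\phi$ (resp. $\vDash_{fin}\phi$) means $\mathcal H,\varsigma\vDash\phi$ for every interpretation $\mathcal H$ with medium (resp. finite) support and every valuation $\varsigma$ to $\mathcal H$.
   Formalization: The support supp(x) is taken least among supporting sets contained in some permission set; least among all supporting sets would force it empty, since every set of all atoms but one supports everything, and then all permutation actions would be trivial. -}

module Defs where

open import Level using (Level; _⊔_; 0ℓ) renaming (suc to lsuc)
open import Data.Empty using (⊥; ⊥-elim)
open import Data.Fin.Base using (Fin)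
open import Data.List.Base using (List; []; _∷_; _++_; [_]; reverse; length; lookup)
open import Data.List.Membership.Propositional using (_∈_)
open import Data.List.Properties using (unfold-reverse; reverse-involutive)
import Data.Nat.Properties as ℕ
open import Data.Nat.Base using (ℕ)
open import Data.Product.Base using (Σ; ∃; _×_; _,_; proj₁; proj₂)
open import Data.Sum.Base using (_⊎_; inj₁; inj₂)
open import Function.Bundles using (Func; Injection; _⇔_; mk⇔; Equivalence)
import Function.Construct.Composition as Comp
import Function.Construct.Identity as Ident
import Function.Construct.Symmetry as Symm
open import Relation.Binary.Bundles using (Setoid)
open import Relation.Binary.Definitions using (DecidableEquality)
open import Relation.Binary.PropositionalEquality
  using (_≡_; _≢_; refl; sym; trans; cong; subst; setoid)
open import Relation.Nullary.Decidable.Core using (yes; no)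
open import Relation.Nullary.Negation.Core using (¬_)
open import Relation.Unary using (Pred; _⊆_; _∩_; _∖_) renaming (_∈_ to _∈ₚ_; _∉_ to _∉ₚ_)

------------------------------------------------------------------------
-- Atoms

-- 𝔸 i is the disjoint union of the countably infinite sets 𝔸^<_i
-- (constructor lt) and 𝔸^>_i (constructor gt).
data 𝔸 (i : ℕ) : Set where
  lt gt : ℕ → 𝔸 i

_≟ᵃ_ : ∀ {i} → DecidableEquality (𝔸 i)
lt m ≟ᵃ lt n with m ℕ.≟ n
... | yes refl = yes refl
... | no m≢n   = no λ { refl → m≢n refl }
lt m ≟ᵃ gt n = no λ ()
gt m ≟ᵃ lt n = no λ ()
gt m ≟ᵃ gt n with m ℕ.≟ n
... | yes refl = yes refl
... | no m≢n   = no λ { refl → m≢n refl }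

Atom : Set
Atom = Σ ℕ 𝔸

AtomSet : Set₁
AtomSet = Pred Atom 0ℓ

data 𝔸^< : AtomSet where
  lt : ∀ {i} n → 𝔸^< (i , lt n)

OfSort : ℕ → AtomSet
OfSort i a = proj₁ a ≡ i

Finite : AtomSet → Set
Finite A = ∃ λ as → A ⊆ (_∈ as)

Infinite : AtomSet → Set
Infinite A = ¬ Finite A

------------------------------------------------------------------------
-- Permutations

record Swapping : Set where
  constructor ⟨_,_⟩
  field
    {sort} : ℕ
    a b    : 𝔸 sort

swap : ∀ {i} → 𝔸 i → 𝔸 i → 𝔸 i → 𝔸 i
swap a b c with c ≟ᵃ a | c ≟ᵃ b
... | yes _ | _     = b
... | no _  | yes _ = a
... | no _  | no _  = c

swapping : Swapping → ∀ {i} → 𝔸 i → 𝔸 i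
swapping (⟨_,_⟩ {j} a b) {i} c with i ℕ.≟ j
... | yes refl = swap a b c
... | no _     = c

-- ℙ_fin is the group generated by swappings: an element is given by a word
-- of swappings, and words are identified (_≗_) when they denote the same
-- bijection.  Composition is _++_, the identity is [], inverse is reverse.
Perm : Set
Perm = List Swapping

infixr 8 _$_
_$_ : Perm → ∀ {i} → 𝔸 i → 𝔸 i
[]      $ c = c
(s ∷ π) $ c = swapping s (π $ c)

infix 4 _≗_
_≗_ : Perm → Perm → Set
π ≗ σ = ∀ {i} (a : 𝔸 i) → π $ a ≡ σ $ a

infixr 8 _$ᵃ_
_$ᵃ_ : Perm → Atom → Atom
π $ᵃ (i , a) = i , π $ a

_∙ˢ_ : Perm → AtomSet → AtomSet
(π ∙ˢ A) b = ∃ λ a → A a × π $ᵃ a ≡ b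

-- A is contained in some permission set π · 𝔸^<.
Permitted : AtomSet → Set
Permitted A = ∃ λ π → A ⊆ π ∙ˢ 𝔸^<

swap-involutive : ∀ {i} (a b c : 𝔸 i) → swap a b (swap a b c) ≡ c
swap-involutive a b c with c ≟ᵃ a | c ≟ᵃ b
swap-involutive a b c | yes refl | _ with b ≟ᵃ a | b ≟ᵃ b
... | yes b≡a | _     = b≡a
... | no _    | yes _ = refl
... | no _    | no n  = ⊥-elim (n refl)
swap-involutive a b c | no _ | yes refl with a ≟ᵃ a | a ≟ᵃ b
... | yes _ | _ = refl
... | no n  | _ = ⊥-elim (n refl)
swap-involutive a b c | no c≢a | no c≢b with c ≟ᵃ a | c ≟ᵃ b
... | yes p | _     = ⊥-elim (c≢a p)
... | no _  | yes p = ⊥-elim (c≢b p)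
... | no _  | no _  = refl

swapping-involutive : ∀ s {i} (c : 𝔸 i) → swapping s (swapping s c) ≡ c
swapping-involutive (⟨_,_⟩ {j} a b) {i} c with i ℕ.≟ j in eq
... | yes refl rewrite eq = swap-involutive a b c
... | no _     rewrite eq = refl

$-++ : ∀ π σ {i} (c : 𝔸 i) → (π ++ σ) $ c ≡ π $ σ $ c
$-++ []      σ c = refl
$-++ (s ∷ π) σ c = cong (swapping s) ($-++ π σ c)

$-inverseˡ : ∀ π → (reverse π ++ π) ≗ []
$-inverseˡ []      c = refl
$-inverseˡ (s ∷ π) c
  rewrite $-++ (reverse (s ∷ π)) (s ∷ π) c
        | unfold-reverse s π
        | $-++ (reverse π) [ s ] (swapping s (π $ c))
        | swapping-involutive s (π $ c)
  = trans (sym ($-++ (reverse π) π c)) ($-inverseˡ π c)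

$-inverseʳ : ∀ π → (π ++ reverse π) ≗ []
$-inverseʳ π c =
  subst (λ σ → (σ ++ reverse π) $ c ≡ c) (reverse-involutive π)
        ($-inverseˡ (reverse π) c)

$-revˡ : ∀ π {i} (c : 𝔸 i) → reverse π $ π $ c ≡ c
$-revˡ π c = trans (sym ($-++ (reverse π) π c)) ($-inverseˡ π c)

$-revʳ : ∀ π {i} (c : 𝔸 i) → π $ reverse π $ c ≡ c
$-revʳ π c = trans (sym ($-++ π (reverse π) c)) ($-inverseʳ π c)

$-injective : ∀ π {i} {a b : 𝔸 i} → π $ a ≡ π $ b → a ≡ b
$-injective π {a = a} {b} eq =
  trans (sym ($-revˡ π a)) (trans (cong (reverse π $_) eq) ($-revˡ π b))

swap-conj : ∀ π {i} (a b c : 𝔸 i) → π $ swap a b c ≡ swap (π $ a) (π $ b) (π $ c)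
swap-conj π a b c with c ≟ᵃ a | c ≟ᵃ b | (π $ c) ≟ᵃ (π $ a) | (π $ c) ≟ᵃ (π $ b)
... | yes _    | _        | yes _ | _     = refl
... | yes refl | _        | no n  | _     = ⊥-elim (n refl)
... | no n     | _        | yes p | _     = ⊥-elim (n ($-injective π p))
... | no _     | yes _    | no _  | yes _ = refl
... | no _     | yes refl | no _  | no n  = ⊥-elim (n refl)
... | no _     | no n     | no _  | yes p = ⊥-elim (n ($-injective π p))
... | no _     | no _     | no _  | no _  = refl

swapping-conj : ∀ π {j} (a b : 𝔸 j) →
                (π ++ [ ⟨ a , b ⟩ ]) ≗ ([ ⟨ π $ a , π $ b ⟩ ] ++ π)
swapping-conj π {j} a b {i} c rewrite $-++ π [ ⟨ a , b ⟩ ] c with i ℕ.≟ j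
... | yes refl = swap-conj π a b c
... | no _     = refl

------------------------------------------------------------------------
-- Sets with a permutation action and permissive-nominal sets

-- "Sets" are setoids, so that sets of abstractions can be formed without
-- quotients; membership and equality are understood up to _≈_ throughout.
record PermSet (ℓ : Level) : Set (lsuc ℓ) where
  infixr 7 _·_
  field
    carrier : Setoid ℓ ℓ
  open Setoid carrier public renaming (refl to ≈-refl; sym to ≈-sym; trans to ≈-trans)
  field
    _·_    : Perm → Carrier → Carrier
    ·-cong : ∀ {π σ x y} → π ≗ σ → x ≈ y → π · x ≈ σ · y
    ·-id   : ∀ x → [] · x ≈ x
    ·-++   : ∀ π σ x → (π ++ σ) · x ≈ π · σ · x

  Supports : AtomSet → Carrier → Set ℓ
  Supports A x = ∀ π → (∀ a → A a → π $ᵃ a ≡ a) → π · x ≈ x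

  ·-congʳ : ∀ π {x y} → x ≈ y → π · x ≈ π · y
  ·-congʳ π = ·-cong {π} {π} (λ _ → refl)

  ·-revˡ : ∀ π x → reverse π · π · x ≈ x
  ·-revˡ π x = ≈-trans (≈-sym (·-++ (reverse π) π x))
    (≈-trans (·-cong {reverse π ++ π} {[]} ($-inverseˡ π) ≈-refl) (·-id x))

  ·-revʳ : ∀ π x → π · reverse π · x ≈ x
  ·-revʳ π x = ≈-trans (≈-sym (·-++ π (reverse π) x))
    (≈-trans (·-cong {π ++ reverse π} {[]} ($-inverseʳ π) ≈-refl) (·-id x))

-- supp x is the least among the supporting sets that are contained in a
-- permission set.  The restriction on the sets A compared with supp x is
-- essential: a finite-support permutation fixing all atoms but one is the
-- identity, so every 𝔸 ∖ {a} supports every element, and a support least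
-- among arbitrary supporting sets would exist only for trivial actions.
record PNSet (ℓ : Level) : Set (lsuc ℓ) where
  field
    permSet : PermSet ℓ
  open PermSet permSet public
  field
    supp           : Carrier → AtomSet
    supp-permitted : ∀ x → Permitted (supp x)
    supp-supports  : ∀ x → Supports (supp x) x
    supp-least     : ∀ x (A : AtomSet) → Permitted A → Supports A x → supp x ⊆ A

  supp-resp : ∀ {x y} → x ≈ y → supp x ⊆ supp y
  supp-resp {x} {y} x≈y = supp-least x (supp y) (supp-permitted y) λ π fix →
    ≈-trans (·-congʳ π x≈y) (≈-trans (supp-supports y π fix) (≈-sym x≈y))

  supp-· : ∀ π x a → (π $ᵃ a) ∈ₚ supp (π · x) → a ∈ₚ supp x
  supp-· π x a p =
    subst (supp x) (cong (proj₁ a ,_) ($-revˡ π (proj₂ a)))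
      (supp-least (π · x) B permitted supports p)
    where
    B : AtomSet
    B b = (reverse π $ᵃ b) ∈ₚ supp x

    permitted : Permitted B
    permitted with supp-permitted x
    ... | σ , sub = π ++ σ , λ {b} b∈B → let c , c< , eq = sub b∈B in
      c , c< , trans (cong (proj₁ c ,_) ($-++ π σ (proj₂ c)))
                 (trans (cong (π $ᵃ_) eq) (cong (proj₁ b ,_) ($-revʳ π (proj₂ b))))

    supports : Supports B (π · x)
    supports τ fix =
      ≈-trans (≈-sym (·-revʳ π (τ · π · x))) (·-congʳ π
        (≈-trans (·-congʳ (reverse π) (≈-sym (·-++ τ π x)))
        (≈-trans (≈-sym (·-++ (reverse π) (τ ++ π) x))
        (supp-supports x (reverse π ++ (τ ++ π)) fix′))))
      where
      fix′ : ∀ c → supp x c → (reverse π ++ (τ ++ π)) $ᵃ c ≡ c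
      fix′ (i , c) c∈ = trans
        (cong (i ,_) (trans ($-++ (reverse π) (τ ++ π) c) (cong (reverse π $_) ($-++ τ π c))))
        (trans (cong (reverse π $ᵃ_) (fix (i , π $ c)
                 (subst (λ d → supp x (i , d)) (sym ($-revˡ π c)) c∈)))
               (cong (i ,_) ($-revˡ π c)))

record EquivariantMap {k ℓ} (X : PermSet k) (Y : PermSet ℓ) : Set (k ⊔ ℓ) where
  private
    module X = PermSet X
    module Y = PermSet Y
  field
    func        : Func X.carrier Y.carrier
  open Func func public using (to)
  field
    equivariant : ∀ π x → to (π X.· x) Y.≈ π Y.· to x

record EquivariantInjection {k ℓ} (X : PermSet k) (Y : PermSet ℓ) : Set (k ⊔ ℓ) where
  private
    module X = PermSet X
    module Y = PermSet Y
  field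
    injection   : Injection X.carrier Y.carrier
  open Injection injection public using (to)
  field
    equivariant : ∀ π x → to (π X.· x) Y.≈ π Y.· to x

record EquivariantSubset {ℓ} (X : PermSet ℓ) : Set (lsuc ℓ) where
  open PermSet X
  field
    member      : Pred Carrier ℓ
    resp        : ∀ {x y} → x ≈ y → member x → member y
    equivariant : ∀ π x → member x ⇔ member (π · x)

Atoms : ℕ → PermSet 0ℓ
Atoms ν = record
  { carrier = setoid (𝔸 ν)
  ; _·_     = λ π a → π $ a
  ; ·-cong  = λ { {x = a} π≗σ refl → π≗σ a }
  ; ·-id    = λ _ → refl
  ; ·-++    = λ π σ a → $-++ π σ a
  }

∏ : ∀ {ℓ n} → (Fin n → PNSet ℓ) → PermSet ℓ
∏ {n = n} X = record
  { carrier = record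
    { Carrier       = ∀ i → X.Carrier i
    ; _≈_           = λ x y → ∀ i → X._≈_ i (x i) (y i)
    ; isEquivalence = record
      { refl  = λ i → X.≈-refl i
      ; sym   = λ p i → X.≈-sym i (p i)
      ; trans = λ p q i → X.≈-trans i (p i) (q i)
      }
    }
  ; _·_     = λ π x i → X._·_ i π (x i)
  ; ·-cong  = λ {π} {σ} π≗σ p i → X.·-cong i {π} {σ} π≗σ (p i)
  ; ·-id    = λ x i → X.·-id i (x i)
  ; ·-++    = λ π σ x i → X.·-++ i π σ (x i)
  }
  where module X (i : Fin n) = PNSet (X i)

------------------------------------------------------------------------
-- Abstractions

module _ {ℓ} (ν : ℕ) (X : PNSet ℓ) where
  open PNSet X

  -- [ a ]ₐ x names the set of pairs [a]x whose membership relation is _∈ᵃ_.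
  record AbsPair : Set ℓ where
    constructor [_]ₐ_
    field
      atom : 𝔸 ν
      body : Carrier
  open AbsPair

  _∈ᵃ_ : 𝔸 ν × Carrier → AbsPair → Set ℓ
  (c , z) ∈ᵃ ([ a ]ₐ x) =
    (c ≡ a × z ≈ x) ⊎
    (c ≢ a × (ν , c) ∉ₚ supp x × z ≈ [ ⟨ c , a ⟩ ] · x)

  ∈ᵃ-resp : ∀ {a a′ c c′ x x′ z z′} → a ≡ a′ → x ≈ x′ → c ≡ c′ → z ≈ z′ →
            (c , z) ∈ᵃ ([ a ]ₐ x) → (c′ , z′) ∈ᵃ ([ a′ ]ₐ x′)
  ∈ᵃ-resp refl x≈ refl z≈ (inj₁ (p , q)) =
    inj₁ (p , ≈-trans (≈-sym z≈) (≈-trans q x≈))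
  ∈ᵃ-resp refl x≈ refl z≈ (inj₂ (p , q , r)) =
    inj₂ (p , (λ s → q (supp-resp (≈-sym x≈) s))
            , ≈-trans (≈-sym z≈) (≈-trans r (·-congʳ _ x≈)))

  ∈ᵃ-equivariant : ∀ π {a c x z} → (c , z) ∈ᵃ ([ a ]ₐ x) →
                   (π $ c , π · z) ∈ᵃ ([ π $ a ]ₐ (π · x))
  ∈ᵃ-equivariant π (inj₁ (p , q)) = inj₁ (cong (π $_) p , ·-congʳ π q)
  ∈ᵃ-equivariant π {a} {c} {x} (inj₂ (p , q , r)) =
    inj₂ ( (λ s → p ($-injective π s))
         , (λ s → q (supp-· π x (ν , c) s))
         , ≈-trans (·-congʳ π r)
             (≈-trans (≈-sym (·-++ π [ ⟨ c , a ⟩ ] x))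
             (≈-trans (·-cong {π ++ [ ⟨ c , a ⟩ ]} {[ ⟨ π $ c , π $ a ⟩ ] ++ π}
                              (swapping-conj π c a) ≈-refl)
                      (·-++ [ ⟨ π $ c , π $ a ⟩ ] π x))) )

  _≐ᵃ_ : AbsPair → AbsPair → Set ℓ
  u ≐ᵃ v = ∀ p → p ∈ᵃ u ⇔ p ∈ᵃ v

  private
    ≐ᵃ-resp : ∀ {a a′ x x′} → a ≡ a′ → x ≈ x′ → ([ a ]ₐ x) ≐ᵃ ([ a′ ]ₐ x′)
    ≐ᵃ-resp p q _ = mk⇔ (∈ᵃ-resp p q refl ≈-refl)
                        (∈ᵃ-resp (sym p) (≈-sym q) refl ≈-refl)

    half : ∀ π σ {a b x y} → π ≗ σ → (∀ p → p ∈ᵃ ([ a ]ₐ x) → p ∈ᵃ ([ b ]ₐ y)) →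
           ∀ p → p ∈ᵃ ([ π $ a ]ₐ (π · x)) → p ∈ᵃ ([ σ $ b ]ₐ (σ · y))
    half π σ {a} {b} {x} {y} π≗σ sub (c , z) p =
      ∈ᵃ-resp (π≗σ b) (·-cong {π} {σ} π≗σ ≈-refl) ($-revʳ π c) (·-revʳ π z)
        (∈ᵃ-equivariant π (sub _
          (∈ᵃ-resp ($-revˡ π a) (·-revˡ π x) refl ≈-refl
            (∈ᵃ-equivariant (reverse π) p))))

  Abs : PermSet ℓ
  Abs = record
    { carrier = record
      { Carrier       = AbsPair
      ; _≈_           = _≐ᵃ_
      ; isEquivalence = record
        { refl  = λ _ → Ident.⇔-id _
        ; sym   = λ f p → Symm.⇔-sym (f p)
        ; trans = λ f g p → Comp._⇔-∘_ (g p) (f p)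
        }
      }
    ; _·_     = λ { π ([ a ]ₐ x) → [ π $ a ]ₐ (π · x) }
    ; ·-cong  = λ {π} {σ} π≗σ eq p → mk⇔
        (half π σ π≗σ (λ q → Equivalence.to (eq q)) p)
        (half σ π (λ c → sym (π≗σ c)) (λ q → Equivalence.from (eq q)) p)
    ; ·-id    = λ { ([ a ]ₐ x) → ≐ᵃ-resp refl (·-id x) }
    ; ·-++    = λ { π σ ([ a ]ₐ x) → ≐ᵃ-resp ($-++ π σ a) (·-++ π σ x) }
    }

------------------------------------------------------------------------
-- Syntax

-- Membership of 𝒜 is an irrelevant argument, so each ν ∈ 𝒜 yields one sort.
data Sort {s} (𝒜 : Pred ℕ 0ℓ) (ℬ : Set s) : Set s where
  name  : (ν : ℕ) → .(𝒜 ν) → Sort 𝒜 ℬ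
  base  : ℬ → Sort 𝒜 ℬ
  tuple : List (Sort 𝒜 ℬ) → Sort 𝒜 ℬ
  abs   : (ν : ℕ) → .(𝒜 ν) → Sort 𝒜 ℬ → Sort 𝒜 ℬ

record Signature (s : Level) : Set (lsuc s) where
  field
    𝒜         : Pred ℕ 0ℓ
    ℬ         : Set s
    Const     : Set s
    constSort : Const → ℬ
    pmss      : Const → AtomSet
    pmss⊆𝔸^<  : ∀ C → pmss C ⊆ 𝔸^<
    Unknown   : Set s
    -- used only to define the update ς[X:=x]
    _≟ᵘ_      : DecidableEquality Unknown
    unkSort   : Unknown → Sort 𝒜 ℬ
    TermF     : Set s
    argSort   : TermF → Sort 𝒜 ℬ
    resSort   : TermF → ℬ
    PropF     : Set s
    propSort  : PropF → Sort 𝒜 ℬ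

module _ {s} (S : Signature s) where
  open Signature S

  data Term : Sort 𝒜 ℬ → Set s where
    atom  : ∀ {ν} .(ν∈𝒜 : 𝒜 ν) → 𝔸 ν → Term (name ν ν∈𝒜)
    const : Perm → (C : Const) → Term (base (constSort C))
    unk   : Perm → (X : Unknown) → Term (unkSort X)
    app   : (f : TermF) → Term (argSort f) → Term (base (resSort f))
    tuple : ∀ αs → (∀ i → Term (lookup αs i)) → Term (tuple αs)
    abs   : ∀ {ν} .(ν∈𝒜 : 𝒜 ν) {α} → 𝔸 ν → Term α → Term (abs ν ν∈𝒜 α)

  data Proposition : Set s where
    ⊥′    : Proposition
    _⇒′_  : Proposition → Proposition → Proposition
    ∀′    : Unknown → Proposition → Proposition
    pred  : (P : PropF) → Term (propSort P) → Proposition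

------------------------------------------------------------------------
-- Semantics

  record Interpretation (ℓ : Level) : Set (s ⊔ lsuc ℓ) where
    field
      ⟦_⟧ : Sort 𝒜 ℬ → PNSet ℓ
    module ⟦⟧ (α : Sort 𝒜 ℬ) = PNSet ⟦ α ⟧
    field
      atomᴴ  : ∀ ν .(ν∈𝒜 : 𝒜 ν) →
               EquivariantInjection (Atoms ν) (⟦⟧.permSet (name ν ν∈𝒜))
      absᴴ   : ∀ ν .(ν∈𝒜 : 𝒜 ν) α →
               EquivariantInjection (Abs ν ⟦ α ⟧) (⟦⟧.permSet (abs ν ν∈𝒜 α))
      tupleᴴ : ∀ αs →
               EquivariantInjection (∏ λ i → ⟦ lookup αs i ⟧) (⟦⟧.permSet (tuple αs))
      appᴴ   : ∀ f →
               EquivariantMap (⟦⟧.permSet (argSort f)) (⟦⟧.permSet (base (resSort f)))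
      constᴴ : ∀ C → ⟦⟧.Carrier (base (constSort C))
      constᴴ-supp : ∀ C → ⟦⟧.supp (base (constSort C)) (constᴴ C) ⊆ pmss C
      predᴴ  : ∀ P → EquivariantSubset (⟦⟧.permSet (propSort P))

  module _ {ℓ} (H : Interpretation ℓ) where
    open Interpretation H

    Lower : Sort 𝒜 ℬ → Set ℓ
    Lower α = Σ (⟦⟧.Carrier α) λ x → ⟦⟧.supp α x ⊆ 𝔸^<

    Valuation : Set (s ⊔ ℓ)
    Valuation = ∀ X → Lower (unkSort X)

    _[_:=_] : Valuation → (X : Unknown) → Lower (unkSort X) → Valuation
    (ς [ X := x ]) Y with X ≟ᵘ Y
    ... | yes refl = x
    ... | no _     = ς Y

    ⟦_⟧ᵗ : ∀ {α} → Term α → Valuation → ⟦⟧.Carrier α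
    ⟦ atom {ν} ν∈𝒜 a ⟧ᵗ      ς = EquivariantInjection.to (atomᴴ ν ν∈𝒜) a
    ⟦ const π C ⟧ᵗ           ς = ⟦⟧._·_ _ π (constᴴ C)
    ⟦ unk π X ⟧ᵗ             ς = ⟦⟧._·_ _ π (proj₁ (ς X))
    ⟦ app f r ⟧ᵗ             ς = EquivariantMap.to (appᴴ f) (⟦ r ⟧ᵗ ς)
    ⟦ tuple αs r ⟧ᵗ          ς = EquivariantInjection.to (tupleᴴ αs) (λ i → ⟦ r i ⟧ᵗ ς)
    ⟦ abs {ν} ν∈𝒜 {α} a r ⟧ᵗ ς = EquivariantInjection.to (absᴴ ν ν∈𝒜 α) ([ a ]ₐ ⟦ r ⟧ᵗ ς)

    _⊨_ : Valuation → Proposition → Set ℓ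
    ς ⊨ ⊥′       = Level.Lift ℓ ⊥
    ς ⊨ (φ ⇒′ ψ) = ¬ (ς ⊨ φ) ⊎ (ς ⊨ ψ)
    ς ⊨ ∀′ X φ   = ∀ x → (ς [ X := x ]) ⊨ φ
    ς ⊨ pred P r = EquivariantSubset.member (predᴴ P) (⟦ r ⟧ᵗ ς)

    FiniteSupport : Set (s ⊔ ℓ)
    FiniteSupport = ∀ α x → Finite (⟦⟧.supp α x)

    MediumSupport : AtomSet → Set (s ⊔ ℓ)
    MediumSupport A = ∀ α x → ∃ λ π → ⟦⟧.supp α x ⊆ π ∙ˢ A

  ⊨fin : (ℓ : Level) → Proposition → Set (s ⊔ lsuc ℓ)
  ⊨fin ℓ φ = ∀ (H : Interpretation ℓ) → FiniteSupport H →
             ∀ (ς : Valuation H) → _⊨_ H ς φ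

  ⊨med : (ℓ : Level) → AtomSet → Proposition → Set (s ⊔ lsuc ℓ)
  ⊨med ℓ A φ = ∀ (H : Interpretation ℓ) → MediumSupport H A →
               ∀ (ς : Valuation H) → _⊨_ H ς φ

-- The fixed set 𝔸^≪ = ⋃ᵢ 𝔸^≪_i.
record MediumSet : Set₁ where
  field
    𝔸^≪          : AtomSet
    𝔸^≪⊆𝔸^<      : 𝔸^≪ ⊆ 𝔸^<
    infinite     : ∀ i → Infinite (OfSort i ∩ 𝔸^≪)
    co-infinite  : ∀ i → Infinite (OfSort i ∩ (𝔸^< ∖ 𝔸^≪))

{-# OPTIONS --safe #-}
module Submission where

open import Defs
open import Level using (Level; _⊔_; 0ℓ; Lift; lift)
open import Axiom.ExcludedMiddle using (ExcludedMiddle)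
open import Data.Empty using (⊥-elim)
open import Data.List.Base using (List; []; _∷_; _++_; [_]; map; reverse; concat; tabulate; lookup)
open import Data.List.Membership.Propositional using (_∈_; _∉_)
open import Data.List.Membership.Propositional.Properties
  using (∈-++⁺ˡ; ∈-++⁺ʳ; ∈-map⁺; ∈-concat⁺′; ∈-tabulate⁺)
open import Data.List.Properties using (map-++)
open import Data.List.Relation.Unary.Any using (here; there; any?)
open import Data.Nat.Base using (ℕ; zero; suc; _<_) renaming (_⊔_ to _⊔ℕ_)
import Data.Nat.Properties as ℕ
open import Data.Product.Base using (∃; _×_; _,_; proj₁; proj₂)
open import Data.Product.Properties using (≡-dec)
open import Data.Sum.Base using (_⊎_; inj₁; inj₂; [_,_]′)
open import Function.Base using (id; _∘_; _∋_)
open import Function.Bundles using (Func; Injection; _⇔_; mk⇔; Equivalence)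
open import Relation.Binary.Definitions using (DecidableEquality; tri<; tri≈; tri>)
open import Relation.Binary.PropositionalEquality
  using (_≡_; _≢_; refl; sym; trans; cong; subst)
open import Relation.Nullary.Decidable.Core using (Dec; yes; no)
open import Relation.Unary using (_⊆_; _∩_; _∖_) renaming (_∈_ to _∈ₚ_; _∉_ to _∉ₚ_)

-- Finite support implies medium support, because a finite permutation moves
-- any finite set of atoms into 𝔸^≪ (move-into, finite⇒⊆∙).  Hence validity
-- over medium support implies validity over finite support.
--
-- For the converse, fix a proposition φ and an interpretation H with medium
-- support.  A finite permutation moves only finitely many atoms, so the
-- support of each element of H is contained in 𝔸^≪ up to finitely many atoms
-- (perm-image).  Let N be a finite list of atoms that contains every atom
-- occurring in φ and, for every constant occurring in φ, the atoms outside
-- 𝔸^≪ that its denotation may depend on.  There is an injection ι of the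
-- atoms, preserving sorts, that is the identity on N and on 𝔸^>, and maps
-- the other atoms of 𝔸^< into 𝔸^< outside 𝔸^≪ (AvoidingInjection).
--
-- Let π act on an element x of H as the renamed permutation, the one that
-- sends ι a to ι (π a) and fixes all atoms outside the image of ι.  For this
-- action the support of x is the inverse image of supp x under ι, which is
-- finite since ι a lies in 𝔸^≪ only when a is in N (pullback).  With a read
-- as ι a, this yields an interpretation on the same carriers with finite
-- support.  It gives φ the same truth value as H (⊨-agrees): ι fixes
-- the atoms of φ, and an element has support in 𝔸^< for the new action
-- exactly when it does for the old one, so the quantifiers range over the
-- same elements.
--
-- The denotation c of a constant C must also have new support inside
-- pmss C.  If it does not, then C does not occur in φ, and c is replaced by
-- some π · c that does have this property (const-with-support).

lowerEM : ∀ {a} b → ExcludedMiddle (a ⊔ b) → ExcludedMiddle a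
lowerEM {a} b em {P} with em {Lift (a ⊔ b) P}
... | yes (lift p) = yes p
... | no ¬p        = no (¬p ∘ lift)

-- Sets of atoms that are infinite in every sort

-- A has infinitely many atoms of each sort, in the positive form that every
-- finite list misses one of them.
Abundant : AtomSet → Set
Abundant A = ∀ i (L : List Atom) → ∃ λ (a : 𝔸 i) → (i , a) ∈ₚ A × (i , a) ∉ L

index : Atom → ℕ
index (_ , lt n) = n
index (_ , gt n) = n

index-bounded : ∀ L → ∃ λ n → ∀ {c} → c ∈ L → index c < n
index-bounded []      = 0 , λ ()
index-bounded (c ∷ L) with index-bounded L
... | n , below = suc (index c) ⊔ℕ n , λ
  { (here refl) → ℕ.m≤m⊔n (suc (index c)) n
  ; (there p)   → ℕ.≤-trans (below p) (ℕ.m≤n⊔m (suc (index c)) n) }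

fresh-index : ∀ L → ∃ λ n → ∀ c → index c ≡ n → c ∉ L
fresh-index L with index-bounded L
... | n , below = n , λ { c refl p → ℕ.<-irrefl refl (below p) }

𝔸^<-abundant : Abundant 𝔸^<
𝔸^<-abundant i L = let n , fresh = fresh-index L in
  lt n , lt n , fresh (i , lt n) refl

upper-fresh : ∀ i L → ∃ λ n → (i , gt n) ∉ L
upper-fresh i L = let n , fresh = fresh-index L in n , fresh (i , gt n) refl

-- Finite permutations move finitely many atoms

-- The atoms occurring in a word of swappings.  They include all atoms moved
-- by the permutation, but also atoms whose swappings cancel out.
atomsᵖ : Perm → List Atom
atomsᵖ []                  = []
atomsᵖ (⟨_,_⟩ {j} a b ∷ π) = (j , a) ∷ (j , b) ∷ atomsᵖ π

swap-left : ∀ {i} (a b : 𝔸 i) → swap a b a ≡ b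
swap-left a b with a ≟ᵃ a | a ≟ᵃ b
... | yes _ | _ = refl
... | no n  | _ = ⊥-elim (n refl)

swap-right : ∀ {i} (a b : 𝔸 i) → swap a b b ≡ a
swap-right a b with b ≟ᵃ a | b ≟ᵃ b
... | yes p | _     = p
... | no _  | yes _ = refl
... | no _  | no n  = ⊥-elim (n refl)

swap-other : ∀ {i} {a b c : 𝔸 i} → c ≢ a → c ≢ b → swap a b c ≡ c
swap-other {a = a} {b} {c} p q with c ≟ᵃ a | c ≟ᵃ b
... | yes r | _     = ⊥-elim (p r)
... | no _  | yes r = ⊥-elim (q r)
... | no _  | no _  = refl

swap-comm : ∀ {i} (a b c : 𝔸 i) → swap a b c ≡ swap b a c
swap-comm a b c with c ≟ᵃ a | c ≟ᵃ b
... | yes refl | yes refl = refl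
... | yes _    | no _     = refl
... | no _     | yes _    = refl
... | no _     | no _     = refl

swap-compose : ∀ {i} {a b c d : 𝔸 i} → d ≢ a → d ≢ c →
               swap c a (swap a b d) ≡ swap c b d
swap-compose {a = a} {b} {c} {d} d≢a d≢c = by-cases (d ≟ᵃ b)
  where
  by-cases : Dec (d ≡ b) → swap c a (swap a b d) ≡ swap c b d
  by-cases (yes refl) = trans (cong (swap c a) (swap-right a b))
                              (trans (swap-right c a) (sym (swap-right c b)))
  by-cases (no d≢b)   = trans (cong (swap c a) (swap-other d≢a d≢b))
                              (trans (swap-other d≢c d≢a) (sym (swap-other d≢c d≢b)))

swapping-same : ∀ {i} (a b c : 𝔸 i) → swapping ⟨ a , b ⟩ c ≡ swap a b c
swapping-same {i} a b c with i ℕ.≟ i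
... | yes refl = refl
... | no n     = ⊥-elim (n refl)

swapping-other : ∀ {i j} (a b : 𝔸 j) (c : 𝔸 i) →
                 (i , c) ≢ (j , a) → (i , c) ≢ (j , b) → swapping ⟨ a , b ⟩ c ≡ c
swapping-other {i} {j} a b c p q with i ℕ.≟ j
... | yes refl = swap-other (λ { refl → p refl }) (λ { refl → q refl })
... | no _     = refl

atomsᵖ-fixed : ∀ π c → c ∉ atomsᵖ π → π $ᵃ c ≡ c
atomsᵖ-fixed []              c       p = refl
atomsᵖ-fixed (⟨ a , b ⟩ ∷ π) (i , c) p =
  trans (cong (λ d → i , swapping ⟨ a , b ⟩ d) π$c≡c)
        (cong (i ,_) (swapping-other a b c (p ∘ here) (p ∘ there ∘ here)))
  where
  π$c≡c : π $ c ≡ c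
  π$c≡c with π $ c | atomsᵖ-fixed π (i , c) (p ∘ there ∘ there)
  ... | _ | refl = refl

_≟ᴬ_ : DecidableEquality Atom
_≟ᴬ_ = ≡-dec ℕ._≟_ _≟ᵃ_

-- π · A differs from A by finitely many atoms.
perm-image : ∀ π {A : AtomSet} {b} → b ∈ₚ π ∙ˢ A →
             b ∈ₚ A ⊎ b ∈ map (π $ᵃ_) (atomsᵖ π)
perm-image π {A} (a , a∈A , refl) with any? (a ≟ᴬ_) (atomsᵖ π)
... | yes a∈π = inj₂ (∈-map⁺ (π $ᵃ_) a∈π)
... | no  a∉π = inj₁ (subst A (sym (atomsᵖ-fixed π a a∉π)) a∈A)

-- Membership in an abstraction

module _ {ℓ} (ν : ℕ) (X : PNSet ℓ) where
  open PNSet X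

  private
    infix 4 _∈[_]_
    _∈[_]_ : 𝔸 ν × Carrier → 𝔸 ν → Carrier → Set ℓ
    p ∈[ a ] x = _∈ᵃ_ ν X p ([ a ]ₐ x)

  -- The action of a permutation on x depends only on its values on supp x.
  supports-agree : ∀ π σ x → (∀ a → a ∈ₚ supp x → π $ᵃ a ≡ σ $ᵃ a) → π · x ≈ σ · x
  supports-agree π σ x agree =
    ≈-trans (≈-sym (·-revʳ σ (π · x)))
            (·-congʳ σ (≈-trans (≈-sym (·-++ (reverse σ) π x))
                                (supp-supports x (reverse σ ++ π) fix)))
    where
    fix : ∀ a → a ∈ₚ supp x → (reverse σ ++ π) $ᵃ a ≡ a
    fix (i , a) p = trans (cong (i ,_) ($-++ (reverse σ) π a))
      (trans (cong (reverse σ $ᵃ_) (agree (i , a) p)) (cong (i ,_) ($-revˡ σ a)))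

  ∈ᵃ-sym : ∀ {a b x y} → (a , x) ∈[ b ] y → (b , y) ∈[ a ] x
  ∈ᵃ-sym (inj₁ (refl , x≈y)) = inj₁ (refl , ≈-sym x≈y)
  ∈ᵃ-sym {a} {b} {x} {y} (inj₂ (a≢b , a∉y , x≈)) =
    inj₂ (a≢b ∘ sym , b∉x , y≈)
    where
    b∉x : (ν , b) ∉ₚ supp x
    b∉x p = a∉y (supp-· [ ⟨ a , b ⟩ ] y (ν , a)
      (subst (λ c → (ν , c) ∈ₚ supp ([ ⟨ a , b ⟩ ] · y))
             (sym (trans (swapping-same a b a) (swap-left a b)))
             (supp-resp x≈ p)))

    y≈ : y ≈ [ ⟨ b , a ⟩ ] · x
    y≈ = ≈-trans
      (≈-trans (≈-sym (·-id y)) (·-cong {[]} {⟨ b , a ⟩ ∷ ⟨ a , b ⟩ ∷ []} eq ≈-refl))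
      (≈-trans (·-++ [ ⟨ b , a ⟩ ] [ ⟨ a , b ⟩ ] y) (·-congʳ _ (≈-sym x≈)))
      where
      eq : [] ≗ (⟨ b , a ⟩ ∷ ⟨ a , b ⟩ ∷ [])
      eq {i} c with i ℕ.≟ ν
      ... | yes refl = sym (trans (swap-comm b a (swap a b c)) (swap-involutive a b c))
      ... | no _ = refl

  -- If [b]y contains (a , x) with a ≢ b, then x is (a b) · y, so a further
  -- pair (c , z) of [a]x has z = (c a) · (a b) · y, which is (c b) · y because
  -- neither a nor c is in supp y.
  ∈ᵃ-⊆ : ∀ {a b x y} → (a , x) ∈[ b ] y → ∀ p → p ∈[ a ] x → p ∈[ b ] y
  ∈ᵃ-⊆ (inj₁ (refl , x≈y)) _ q = ∈ᵃ-resp ν X refl x≈y refl ≈-refl q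
  ∈ᵃ-⊆ m@(inj₂ _) _ (inj₁ (refl , z≈x)) = ∈ᵃ-resp ν X refl ≈-refl refl (≈-sym z≈x) m
  ∈ᵃ-⊆ {a} {b} {x} {y} m@(inj₂ (a≢b , a∉y , x≈)) (c , z) (inj₂ (c≢a , c∉x , z≈))
    with c ≟ᵃ b
  ... | yes refl = inj₁ (refl , ≈-trans z≈ (≈-sym y≈))
    where
    y≈ : y ≈ [ ⟨ b , a ⟩ ] · x
    y≈ with ∈ᵃ-sym m
    ... | inj₁ (b≡a , _) = ⊥-elim (a≢b (sym b≡a))
    ... | inj₂ (_ , _ , r) = r
  ... | no c≢b = inj₂ (c≢b , c∉y , ≈-trans z≈ (≈-trans (·-congʳ _ x≈)
          (≈-trans (≈-sym (·-++ [ ⟨ c , a ⟩ ] [ ⟨ a , b ⟩ ] y))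
            (supports-agree (⟨ c , a ⟩ ∷ ⟨ a , b ⟩ ∷ []) [ ⟨ c , b ⟩ ] y agree))))
    where
    c∉y : (ν , c) ∉ₚ supp y
    c∉y p = c∉x (supp-resp (≈-sym x≈)
      (supp-· [ ⟨ a , b ⟩ ] ([ ⟨ a , b ⟩ ] · y) (ν , c)
        (subst (λ d → (ν , d) ∈ₚ supp ([ ⟨ a , b ⟩ ] · [ ⟨ a , b ⟩ ] · y))
          (sym (trans (swapping-same a b c) (swap-other c≢a c≢b)))
          (supp-resp (≈-sym (≈-trans (≈-sym (·-++ [ ⟨ a , b ⟩ ] [ ⟨ a , b ⟩ ] y))
             (≈-trans (·-cong {⟨ a , b ⟩ ∷ ⟨ a , b ⟩ ∷ []} {[]}
                        (swapping-involutive ⟨ a , b ⟩) ≈-refl) (·-id y)))) p))))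

    agree : ∀ d → d ∈ₚ supp y →
            (⟨ c , a ⟩ ∷ ⟨ a , b ⟩ ∷ []) $ᵃ d ≡ [ ⟨ c , b ⟩ ] $ᵃ d
    agree (i , d) d∈y with i ℕ.≟ ν
    ... | no _     = refl
    ... | yes refl = cong (ν ,_) (swap-compose d≢a d≢c)
      where
      d≢a : d ≢ a
      d≢a refl = a∉y d∈y
      d≢c : d ≢ c
      d≢c refl = c∉y d∈y

  -- An abstraction is determined by any one of its members.
  ∈ᵃ⇒≐ᵃ : ∀ {a b x y} → (a , x) ∈[ b ] y → _≐ᵃ_ ν X ([ a ]ₐ x) ([ b ]ₐ y)
  ∈ᵃ⇒≐ᵃ m p = mk⇔ (∈ᵃ-⊆ m p) (∈ᵃ-⊆ (∈ᵃ-sym m) p)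

-- Renaming permutations along an injection of atoms

,-injective : ∀ {i} {a b : 𝔸 i} → (Atom ∋ i , a) ≡ (i , b) → a ≡ b
,-injective refl = refl

module Renaming (ι : ∀ {i} → 𝔸 i → 𝔸 i)
                (ι-inj : ∀ {i} {a b : 𝔸 i} → ι a ≡ ι b → a ≡ b) where

  ιᵃ : Atom → Atom
  ιᵃ (i , a) = i , ι a

  ιᵃ-inj : ∀ {a b} → ιᵃ a ≡ ιᵃ b → a ≡ b
  ιᵃ-inj {i , a} {j , b} eq with cong proj₁ eq
  ... | refl = cong (i ,_) (ι-inj (,-injective eq))

  renameˢ : Swapping → Swapping
  renameˢ ⟨ a , b ⟩ = ⟨ ι a , ι b ⟩

  -- The permutation that π induces on the image of ι, extended by the identity.
  rename : Perm → Perm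
  rename = map renameˢ

  ι-swap : ∀ {i} (a b c : 𝔸 i) → swap (ι a) (ι b) (ι c) ≡ ι (swap a b c)
  ι-swap a b c with c ≟ᵃ a
  ... | yes refl = swap-left (ι a) (ι b)
  ... | no c≢a with c ≟ᵃ b
  ...   | yes refl = swap-right (ι a) (ι b)
  ...   | no c≢b   = swap-other (c≢a ∘ ι-inj) (c≢b ∘ ι-inj)

  rename-ι : ∀ π {i} (c : 𝔸 i) → rename π $ ι c ≡ ι (π $ c)
  rename-ι []      c = refl
  rename-ι (s ∷ π) c = trans (cong (swapping (renameˢ s)) (rename-ι π c))
                             (ι-swapping s (π $ c))
    where
    ι-swapping : ∀ s {i} (c : 𝔸 i) → swapping (renameˢ s) (ι c) ≡ ι (swapping s c)
    ι-swapping (⟨_,_⟩ {j} a b) {i} c with i ℕ.≟ j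
    ... | yes refl = ι-swap a b c
    ... | no _     = refl

  rename-outside : ∀ π {i} (d : 𝔸 i) → (∀ c → ι c ≢ d) → rename π $ d ≡ d
  rename-outside []              d outside = refl
  rename-outside (⟨ a , b ⟩ ∷ π) d outside =
    trans (cong (swapping ⟨ ι a , ι b ⟩) (rename-outside π d outside))
          (swapping-other (ι a) (ι b) d (λ { refl → outside a refl })
                                        (λ { refl → outside b refl }))

-- Infinite and finite sets of atoms, classically

-- A predicate with a witness outside every finite list has an injective
-- sequence of witnesses.
enumerate : ∀ {X : Set} {P : X → Set} → (∀ L → ∃ λ x → P x × x ∉ L) →
            ∃ λ (e : ℕ → X) → (∀ n → P (e n)) × (∀ {m n} → e m ≡ e n → m ≡ n)
enumerate {X} {P} pick = e , (λ n → proj₁ (proj₂ (pick (before n)))) , e-inj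
  where
  before : ℕ → List X
  before zero    = []
  before (suc n) = proj₁ (pick (before n)) ∷ before n

  e : ℕ → X
  e n = proj₁ (pick (before n))

  e-before : ∀ {m n} → m < n → e m ∈ before n
  e-before {m} {suc n} m<1+n with ℕ.m<1+n⇒m<n∨m≡n m<1+n
  ... | inj₁ m<n  = there (e-before m<n)
  ... | inj₂ refl = here refl

  e-fresh : ∀ {m n} → m < n → e m ≢ e n
  e-fresh {m} {n} m<n eq =
    proj₂ (proj₂ (pick (before n))) (subst (_∈ before n) eq (e-before m<n))

  e-inj : ∀ {m n} → e m ≡ e n → m ≡ n
  e-inj {m} {n} eq with ℕ.<-cmp m n
  ... | tri< m<n _ _ = ⊥-elim (e-fresh m<n eq)
  ... | tri≈ _ m≡n _ = m≡n
  ... | tri> _ _ n<m = ⊥-elim (e-fresh n<m (sym eq))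

module Classical (em : ExcludedMiddle 0ℓ) where

  infinite⇒abundant : ∀ {A : AtomSet} → (∀ i → Infinite (OfSort i ∩ A)) → Abundant A
  infinite⇒abundant {A} inf i L with em {∃ λ (a : 𝔸 i) → (i , a) ∈ₚ A × (i , a) ∉ L}
  ... | yes p = p
  ... | no ¬p = ⊥-elim (inf i (L , covered))
    where
    covered : OfSort i ∩ A ⊆ (_∈ L)
    covered {.i , a} (refl , a∈A) with em {(i , a) ∈ L}
    ... | yes a∈L = a∈L
    ... | no  a∉L = ⊥-elim (¬p (a , a∈A , a∉L))

  preimage-finite : (f : Atom → Atom) → (∀ {a b} → f a ≡ f b → a ≡ b) →
                    ∀ L → Finite (λ a → f a ∈ L)
  preimage-finite f f-inj []      = [] , λ ()
  preimage-finite f f-inj (d ∷ L) with preimage-finite f f-inj L | em {∃ λ a → f a ≡ d}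
  ... | K , sub | yes (a , refl) = a ∷ K , λ
          { (here eq) → here (f-inj eq) ; (there p) → there (sub p) }
  ... | K , sub | no ¬p          = K , λ
          { (here eq) → ⊥-elim (¬p (_ , eq)) ; (there p) → sub p }

  -- If all but finitely many atoms of D are in G, and G has infinitely many
  -- atoms of each sort outside D, then a finite permutation moves D into G.
  -- The list B contains the atoms of D that may lie outside G; each of them in
  -- turn is swapped with an atom of G outside D.
  move-into : ∀ (B : List Atom) {D G : AtomSet} →
              (∀ {a} → a ∈ₚ D → a ∈ₚ G ⊎ a ∈ B) → Abundant (G ∖ D) →
              ∃ λ π → ∀ {a} → a ∈ₚ D → (π $ᵃ a) ∈ₚ G
  move-into []      cover room = [] , λ a∈D → [ id , (λ ()) ]′ (cover a∈D)
  move-into ((i , b) ∷ B) {D} {G} cover room with em {(i , b) ∈ₚ (D ∖ G)}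
  ... | no ¬b = move-into B (λ a∈D → drop a∈D (cover a∈D)) room
    where
    drop : ∀ {a} → a ∈ₚ D → a ∈ₚ G ⊎ a ∈ ((i , b) ∷ B) → a ∈ₚ G ⊎ a ∈ B
    drop a∈D (inj₁ p)           = inj₁ p
    drop a∈D (inj₂ (there p))   = inj₂ p
    drop {a} a∈D (inj₂ (here refl)) with em {a ∈ₚ G}
    ... | yes p = inj₁ p
    ... | no ¬p = ⊥-elim (¬b (a∈D , ¬p))
  ... | yes (b∈D , b∉G) with room i []
  ... | g , (g∈G , g∉D) , _ = π ++ [ τ ] , moved
    where
    τ : Swapping
    τ = ⟨ b , g ⟩

    -- The image of D under τ, which is its own inverse.
    D′ : AtomSet
    D′ a = ([ τ ] $ᵃ a) ∈ₚ D

    g-or-D : ∀ a → a ∈ₚ D′ → a ≡ (i , g) ⊎ (a ∈ₚ D × a ≢ (i , b))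
    g-or-D (j , a) p with em {(j , a) ≡ (i , b)} | em {(j , a) ≡ (i , g)}
    ... | yes refl | _ = ⊥-elim (g∉D (subst (λ c → (i , c) ∈ₚ D)
                            (trans (swapping-same b g b) (swap-left b g)) p))
    ... | no _     | yes q = inj₁ q
    ... | no a≢b   | no a≢g = inj₂
          (subst (λ c → (j , c) ∈ₚ D) (swapping-other b g a a≢b a≢g) p , a≢b)

    cover′ : ∀ {a} → a ∈ₚ D′ → a ∈ₚ G ⊎ a ∈ B
    cover′ {a} p with g-or-D a p
    ... | inj₁ refl = inj₁ g∈G
    ... | inj₂ (a∈D , a≢b) with cover a∈D
    ...   | inj₁ q         = inj₁ q
    ...   | inj₂ (here q)  = ⊥-elim (a≢b q)
    ...   | inj₂ (there q) = inj₂ q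

    room′ : Abundant (G ∖ D′)
    room′ j L with room j ((i , g) ∷ L)
    ... | a , (a∈G , a∉D) , a∉gL = a , (a∈G , a∉D′) , a∉gL ∘ there
      where
      a∉D′ : (j , a) ∉ₚ D′
      a∉D′ p with g-or-D (j , a) p
      ... | inj₁ q         = a∉gL (here q)
      ... | inj₂ (a∈D , _) = a∉D a∈D

    ih : ∃ λ π → ∀ {a} → a ∈ₚ D′ → (π $ᵃ a) ∈ₚ G
    ih = move-into B cover′ room′

    π : Perm
    π = proj₁ ih

    moved : ∀ {a} → a ∈ₚ D → ((π ++ [ τ ]) $ᵃ a) ∈ₚ G
    moved {j , a} a∈D = subst (λ c → (j , c) ∈ₚ G) (sym ($-++ π [ τ ] a))
      (proj₂ ih (subst (λ c → (j , c) ∈ₚ D) (sym (swapping-involutive τ a)) a∈D))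

  finite⇒⊆∙ : ∀ {D G : AtomSet} → Finite D → Abundant G → ∃ λ π → D ⊆ π ∙ˢ G
  finite⇒⊆∙ {D} {G} (L , sub) abundant with move-into L {D} {G} (inj₂ ∘ sub) room
    where
    room : Abundant (G ∖ D)
    room i K with abundant i (L ++ K)
    ... | a , a∈G , a∉ = a , (a∈G , a∉ ∘ ∈-++⁺ˡ ∘ sub) , a∉ ∘ ∈-++⁺ʳ L
  ... | π , into = reverse π , λ {a} a∈D →
        (π $ᵃ a) , into a∈D , cong (proj₁ a ,_) ($-revˡ π (proj₂ a))

  -- An injection of the atoms of each sort that is the identity on N and on
  -- 𝔸^>, and maps the other atoms of 𝔸^< into U.
  module AvoidingInjection (N : List Atom) {U : AtomSet}
                           (U⊆𝔸^< : U ⊆ 𝔸^<) (U-abundant : Abundant U) where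

    -- The values of ι on 𝔸^< off N avoid N, which keeps ι injective.
    target : ∀ i → ∃ λ (e : ℕ → 𝔸 i) →
             (∀ n → (i , e n) ∈ₚ U × (i , e n) ∉ N) × (∀ {m n} → e m ≡ e n → m ≡ n)
    target i = enumerate {P = λ a → (i , a) ∈ₚ U × (i , a) ∉ N} λ L →
      let a , a∈U , a∉ = U-abundant i (N ++ map (i ,_) L)
      in  a , (a∈U , a∉ ∘ ∈-++⁺ˡ) , a∉ ∘ ∈-++⁺ʳ N ∘ ∈-map⁺ (i ,_)

    ι : ∀ {i} → 𝔸 i → 𝔸 i
    ι     (gt n) = gt n
    ι {i} (lt n) with em {(i , lt n) ∈ N}
    ... | yes _ = lt n
    ... | no  _ = proj₁ (target i) n

    ι-fix : ∀ {i} (a : 𝔸 i) → (i , a) ∈ N → ι a ≡ a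
    ι-fix     (gt n) p = refl
    ι-fix {i} (lt n) p with em {(i , lt n) ∈ N}
    ... | yes _ = refl
    ... | no ¬p = ⊥-elim (¬p p)

    ι-lt : ∀ {i} n → (i , ι (lt n)) ∈ₚ 𝔸^<
    ι-lt {i} n with em {(i , lt n) ∈ N}
    ... | yes _ = lt n
    ... | no  _ = U⊆𝔸^< (proj₁ (proj₁ (proj₂ (target i)) n))

    ι-image : ∀ {i} n → (i , lt n) ∈ N ⊎ (i , ι (lt n)) ∈ₚ U
    ι-image {i} n with em {(i , lt n) ∈ N}
    ... | yes p = inj₁ p
    ... | no  _ = inj₂ (proj₁ (proj₁ (proj₂ (target i)) n))

    ι-inj : ∀ {i} {a b : 𝔸 i} → ι a ≡ ι b → a ≡ b
    ι-inj {a = gt _} {gt _} eq = eq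
    ι-inj {i} {gt m} {lt n} eq with ι {i} (lt n) | ι-lt {i} n
    ι-inj {i} {gt m} {lt n} () | .(lt _) | lt _
    ι-inj {i} {lt n} {gt m} eq with ι {i} (lt n) | ι-lt {i} n
    ι-inj {i} {lt n} {gt m} () | .(lt _) | lt _
    ι-inj {i} {lt m} {lt n} eq with em {(i , lt m) ∈ N} | em {(i , lt n) ∈ N}
    ... | yes _ | yes _ = eq
    ... | yes p | no  _ = ⊥-elim (proj₂ (proj₁ (proj₂ (target i)) n)
                            (subst (λ c → (i , c) ∈ N) eq p))
    ... | no  _ | yes p = ⊥-elim (proj₂ (proj₁ (proj₂ (target i)) m)
                            (subst (λ c → (i , c) ∈ N) (sym eq) p))
    ... | no  _ | no  _ = cong lt (proj₂ (proj₂ (target i)) eq)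

-- Atoms of terms and propositions

module _ {s} {S : Signature s} (constAtoms : Signature.Const S → List Atom) where

  -- The atoms occurring in a term, where each constant C contributes the list
  -- constAtoms C.
  atomsᵗ : ∀ {α} → Term S α → List Atom
  atomsᵗ (atom {ν} _ a)  = [ ν , a ]
  atomsᵗ (const π C)     = atomsᵖ π ++ constAtoms C
  atomsᵗ (unk π X)       = atomsᵖ π
  atomsᵗ (app f r)       = atomsᵗ r
  atomsᵗ (tuple αs r)    = concat (tabulate λ i → atomsᵗ (r i))
  atomsᵗ (abs {ν} _ a r) = (ν , a) ∷ atomsᵗ r

  atomsᶠ : Proposition S → List Atom
  atomsᶠ ⊥′         = []
  atomsᶠ (φ ⇒′ ψ)   = atomsᶠ φ ++ atomsᶠ ψ
  atomsᶠ (∀′ X φ)   = atomsᶠ φ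
  atomsᶠ (pred P r) = atomsᵗ r

-- Restricting the action along an injection of atoms

module Pullback (em : ExcludedMiddle 0ℓ) (ι : ∀ {i} → 𝔸 i → 𝔸 i)
                (ι-inj : ∀ {i} {a b : 𝔸 i} → ι a ≡ ι b → a ≡ b) where
  open Classical em
  open Renaming ι ι-inj

  rename-cong : ∀ {π σ} → π ≗ σ → rename π ≗ rename σ
  rename-cong {π} {σ} π≗σ {i} d with em {∃ λ c → ι c ≡ d}
  ... | yes (c , refl) = trans (rename-ι π c) (trans (cong ι (π≗σ c)) (sym (rename-ι σ c)))
  ... | no ¬c          = trans (rename-outside π d (λ c eq → ¬c (c , eq)))
                               (sym (rename-outside σ d (λ c eq → ¬c (c , eq))))

  -- ι is the identity on the atoms in L.
  Fixes : List Atom → Set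
  Fixes L = ∀ {a} → a ∈ L → ιᵃ a ≡ a

  Fixes-at : ∀ {L i} {a : 𝔸 i} → Fixes L → (i , a) ∈ L → ι a ≡ a
  Fixes-at fixes p = ,-injective (fixes p)

  rename-fixed : ∀ π → Fixes (atomsᵖ π) → rename π ≡ π
  rename-fixed []              fixes = refl
  rename-fixed (⟨ a , b ⟩ ∷ π) fixes
    rewrite Fixes-at fixes (here refl)
          | Fixes-at {a = b} fixes (there (here refl))
          | rename-fixed π (fixes ∘ there ∘ there) = refl

  -- The inverse image of a set of atoms under ι.
  ι⁻¹ : AtomSet → AtomSet
  ι⁻¹ A a = ιᵃ a ∈ₚ A

  ι⁻¹-finite : ∀ L → Finite (ι⁻¹ (_∈ L))
  ι⁻¹-finite = preimage-finite ιᵃ ιᵃ-inj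

  -- If ι is the identity on 𝔸^>, then ι⁻¹ A is contained in 𝔸^< exactly when
  -- A is.
  module _ (ι-gt : ∀ {i} n → ι {i} (gt n) ≡ gt n) (A : AtomSet) where

    ι⁻¹-lower⁺ : A ⊆ 𝔸^< → ι⁻¹ A ⊆ 𝔸^<
    ι⁻¹-lower⁺ A⊆ {i , lt n} p = lt n
    ι⁻¹-lower⁺ A⊆ {i , gt n} p with subst (λ c → (i , c) ∈ₚ 𝔸^<) (ι-gt n) (A⊆ p)
    ... | ()

    ι⁻¹-lower⁻ : ι⁻¹ A ⊆ 𝔸^< → A ⊆ 𝔸^<
    ι⁻¹-lower⁻ A⊆ {i , lt n} p = lt n
    ι⁻¹-lower⁻ A⊆ {i , gt n} p
      with A⊆ {i , gt n} (subst (λ c → (i , c) ∈ₚ A) (sym (ι-gt n)) p)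
    ... | ()

  module _ {ℓ} (X : PNSet ℓ) (fin : ∀ x → Finite (ι⁻¹ (PNSet.supp X x))) where
    private module X = PNSet X

    -- The carrier of X, on which π acts as rename π does in X.
    pullback-permSet : PermSet ℓ
    pullback-permSet = record
      { carrier = X.carrier
      ; _·_     = λ π x → rename π X.· x
      ; ·-cong  = λ {π} {σ} π≗σ → X.·-cong {rename π} {rename σ} (rename-cong {π} {σ} π≗σ)
      ; ·-id    = X.·-id
      ; ·-++    = λ π σ x → subst (λ ρ → ρ X.· x X.≈ (rename π X.· rename σ X.· x))
                    (sym (map-++ renameˢ π σ)) (X.·-++ (rename π) (rename σ) x)
      }

    private module X′ = PermSet pullback-permSet

    pullback-supports : ∀ x → X′.Supports (ι⁻¹ (X.supp x)) x
    pullback-supports x π fix = X.supp-supports x (rename π) fix′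
      where
      fix′ : ∀ d → d ∈ₚ X.supp x → rename π $ᵃ d ≡ d
      fix′ (i , d) d∈x with em {∃ λ c → ι c ≡ d}
      ... | yes (c , refl) = trans (cong (i ,_) (rename-ι π c)) (cong ιᵃ (fix (i , c) d∈x))
      ... | no ¬c          = cong (i ,_) (rename-outside π d (λ c eq → ¬c (c , eq)))

    -- Suppose that a in ι⁻¹ (supp x) is not in A.  Since A is contained in a
    -- permission set and ι⁻¹ (supp x) is finite, some b ≢ a is in neither.  The
    -- swapping (a b) fixes A, so (ι a  ι b) · x = x, which puts ι b in supp x
    -- along with ι a.
    pullback-least : ∀ x (A : AtomSet) → Permitted A → X′.Supports A x → ι⁻¹ (X.supp x) ⊆ A
    pullback-least x A (σ , A⊆σ) supports {i , a} ιa∈x with em {(i , a) ∈ₚ A}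
    ... | yes a∈A = a∈A
    ... | no  a∉A = ⊥-elim (b∉ (there (∈-++⁺ˡ (proj₂ (fin x) ιb∈x))))
      where
      avoided : List Atom
      avoided = (i , a) ∷ proj₁ (fin x) ++ map (σ $ᵃ_) (atomsᵖ σ)

      b : 𝔸 i
      b = gt (proj₁ (upper-fresh i avoided))

      b∉ : (i , b) ∉ avoided
      b∉ = proj₂ (upper-fresh i avoided)

      b∉A : (i , b) ∉ₚ A
      b∉A b∈A with perm-image σ {𝔸^<} (A⊆σ b∈A)
      ... | inj₁ ()
      ... | inj₂ p = b∉ (there (∈-++⁺ʳ (proj₁ (fin x)) p))

      fix : ∀ c → c ∈ₚ A → [ ⟨ a , b ⟩ ] $ᵃ c ≡ c
      fix (j , c) c∈A = cong (j ,_) (swapping-other a b c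
        (λ { refl → a∉A c∈A }) (λ { refl → b∉A c∈A }))

      ιb∈x : (i , ι b) ∈ₚ X.supp x
      ιb∈x = X.supp-· [ ⟨ ι a , ι b ⟩ ] x (i , ι b)
        (subst (λ c → (i , c) ∈ₚ X.supp ([ ⟨ ι a , ι b ⟩ ] X.· x))
          (sym (trans (swapping-same (ι a) (ι b) (ι b)) (swap-right (ι a) (ι b))))
          (X.supp-resp (X.≈-sym (supports [ ⟨ a , b ⟩ ] fix)) ιa∈x))

    -- X restricted along ι, when the resulting supports are finite.
    pullback : PNSet ℓ
    pullback = record
      { permSet        = pullback-permSet
      ; supp           = λ x → ι⁻¹ (X.supp x)
      ; supp-permitted = λ x → finite⇒⊆∙ (fin x) 𝔸^<-abundant
      ; supp-supports  = pullback-supports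
      ; supp-least     = pullback-least
      }

    ∈ᵃ-pullback : ∀ {ν c z a x} →
      _∈ᵃ_ ν pullback (c , z) ([ a ]ₐ x) ⇔ _∈ᵃ_ ν X (ι c , z) ([ ι a ]ₐ x)
    ∈ᵃ-pullback = mk⇔
      (λ { (inj₁ (p , q))     → inj₁ (cong ι p , q)
         ; (inj₂ (p , q , r)) → inj₂ (p ∘ ι-inj , q , r) })
      (λ { (inj₁ (p , q))     → inj₁ (ι-inj p , q)
         ; (inj₂ (p , q , r)) → inj₂ (p ∘ cong ι , q , r) })

  -- The constants are reinterpreted by const′, since ι⁻¹ (supp (constᴴ C)) need
  -- not be contained in pmss C.
  module _ {s ℓ} {S : Signature s} (H : Interpretation S ℓ)
           (fin : ∀ α x → Finite (ι⁻¹ (Interpretation.⟦⟧.supp H α x)))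
           (const′ : ∀ C → Interpretation.⟦⟧.Carrier H (base (Signature.constSort S C)))
           (const′-supp : ∀ C →
             ι⁻¹ (Interpretation.⟦⟧.supp H (base (Signature.constSort S C)) (const′ C))
             ⊆ Signature.pmss S C) where
    open Signature S
    open Interpretation H

    -- The atom a denotes what ι a denotes in H.
    atom′ : ∀ ν .(ν∈𝒜 : 𝒜 ν) →
      EquivariantInjection (Atoms ν) (pullback-permSet ⟦ name ν ν∈𝒜 ⟧ (fin (name ν ν∈𝒜)))
    atom′ ν ν∈𝒜 = record
      { injection = record
        { to        = λ a → E.to (ι a)
        ; cong      = λ { refl → ⟦⟧.≈-refl (name ν ν∈𝒜) }
        ; injective = λ p → ι-inj (E.injective p)
        }
      ; equivariant = λ π a → subst
          (λ b → E.to b ≈ν (rename π ·ν E.to (ι a))) (rename-ι π a)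
          (E.equivariant (rename π) (ι a))
      }
      where
      module E where
        open EquivariantInjection (atomᴴ ν ν∈𝒜) public
        open Injection injection public using (injective)
      open ⟦⟧ (name ν ν∈𝒜) using () renaming (_≈_ to _≈ν_; _·_ to _·ν_)

    -- Abstraction of a is abstraction of ι a in H.
    abs′ : ∀ ν .(ν∈𝒜 : 𝒜 ν) α →
      EquivariantInjection (Abs ν (pullback ⟦ α ⟧ (fin α)))
                           (pullback-permSet ⟦ abs ν ν∈𝒜 α ⟧ (fin (abs ν ν∈𝒜 α)))
    abs′ ν ν∈𝒜 α = record
      { injection = record
        { to        = λ { ([ a ]ₐ x) → E.to ([ ι a ]ₐ x) }
        ; cong      = λ { {[ a ]ₐ x} {[ b ]ₐ y} eq → E.cong (∈ᵃ⇒≐ᵃ ν ⟦ α ⟧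
            (to (in-H {b = b} {y}) (to (eq (a , x)) (inj₁ (refl , ⟦⟧.≈-refl α))))) }
        ; injective = λ { {[ a ]ₐ x} {[ b ]ₐ y} eq (c , z) → mk⇔
            (from (in-H {b = b} {y}) ∘ to (E.injective eq (ι c , z)) ∘ to (in-H {b = a} {x}))
            (from (in-H {b = a} {x}) ∘ from (E.injective eq (ι c , z)) ∘ to (in-H {b = b} {y})) }
        }
      ; equivariant = λ { π ([ a ]ₐ x) →
          subst (λ b → E.to ([ b ]ₐ (rename π ·α x)) ≈ν (rename π ·ν E.to ([ ι a ]ₐ x)))
                (rename-ι π a) (E.equivariant (rename π) ([ ι a ]ₐ x)) }
      }
      where
      module E where
        open EquivariantInjection (absᴴ ν ν∈𝒜 α) public
        open Injection injection public using (injective; cong)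
      open Equivalence using (to; from)
      open ⟦⟧ α using () renaming (_·_ to _·α_)
      open ⟦⟧ (abs ν ν∈𝒜 α) using () renaming (_≈_ to _≈ν_; _·_ to _·ν_)

      in-H : ∀ {c z b y} → _∈ᵃ_ ν (pullback ⟦ α ⟧ (fin α)) (c , z) ([ b ]ₐ y) ⇔
                           _∈ᵃ_ ν ⟦ α ⟧ (ι c , z) ([ ι b ]ₐ y)
      in-H = ∈ᵃ-pullback ⟦ α ⟧ (fin α)

    tuple′ : ∀ αs → EquivariantInjection
      (∏ λ i → pullback ⟦ lookup αs i ⟧ (fin (lookup αs i)))
      (pullback-permSet ⟦ tuple αs ⟧ (fin (tuple αs)))
    tuple′ αs = record
      { injection   = record { to = to ; cong = E.cong ; injective = E.injective }
      ; equivariant = λ π → equivariant (rename π)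
      }
      where
      open EquivariantInjection (tupleᴴ αs)
      module E = Injection injection

    app′ : ∀ f → EquivariantMap
      (pullback-permSet ⟦ argSort f ⟧ (fin (argSort f)))
      (pullback-permSet ⟦ base (resSort f) ⟧ (fin (base (resSort f))))
    app′ f = record
      { func        = record { to = to ; cong = Func.cong func }
      ; equivariant = λ π → equivariant (rename π)
      }
      where
      open EquivariantMap (appᴴ f)

    pred′ : ∀ P → EquivariantSubset (pullback-permSet ⟦ propSort P ⟧ (fin (propSort P)))
    pred′ P = record
      { member      = member
      ; resp        = resp
      ; equivariant = λ π → equivariant (rename π)
      }
      where
      open EquivariantSubset (predᴴ P)

    -- H restricted along ι.
    interpretation : Interpretation S ℓ
    interpretation = record
      { ⟦_⟧         = λ α → pullback ⟦ α ⟧ (fin α)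
      ; atomᴴ       = atom′
      ; absᴴ        = abs′
      ; tupleᴴ      = tuple′
      ; appᴴ        = app′
      ; constᴴ      = const′
      ; constᴴ-supp = const′-supp
      ; predᴴ       = pred′
      }

    module _ (ι-gt : ∀ {i} n → ι {i} (gt n) ≡ gt n)
             (constAtoms : Const → List Atom)
             (const′-agrees : ∀ C → Fixes (constAtoms C) → const′ C ≡ constᴴ C) where

      -- Valuations that send each unknown to the same element.
      Related : Valuation S interpretation → Valuation S H → Set (s ⊔ ℓ)
      Related ς′ ς = ∀ X → ⟦⟧._≈_ (unkSort X) (proj₁ (ς′ X)) (proj₁ (ς X))

      Related-update : ∀ {ς′ ς} X x′ x → ⟦⟧._≈_ (unkSort X) (proj₁ x′) (proj₁ x) →
        Related ς′ ς → Related (_[_:=_] S interpretation ς′ X x′) (_[_:=_] S H ς X x)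
      Related-update X x′ x p rel Y with X ≟ᵘ Y
      ... | yes refl = p
      ... | no _     = rel Y

      eval-agrees : ∀ {α} (r : Term S α) {ς′ ς} → Related ς′ ς →
        Fixes (atomsᵗ constAtoms r) →
        ⟦⟧._≈_ α (⟦_⟧ᵗ S interpretation r ς′) (⟦_⟧ᵗ S H r ς)
      eval-agrees (atom {ν} ν∈𝒜 a) rel fixes
        rewrite Fixes-at {a = a} fixes (here refl) = ⟦⟧.≈-refl (name ν ν∈𝒜)
      eval-agrees (const π C) rel fixes
        rewrite rename-fixed π (fixes ∘ ∈-++⁺ˡ)
              | const′-agrees C (fixes ∘ ∈-++⁺ʳ (atomsᵖ π)) = ⟦⟧.≈-refl _
      eval-agrees (unk π X) rel fixes
        rewrite rename-fixed π fixes = ⟦⟧.·-congʳ (unkSort X) π (rel X)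
      eval-agrees (app f r) rel fixes =
        Func.cong (EquivariantMap.func (appᴴ f)) (eval-agrees r rel fixes)
      eval-agrees (tuple αs r) rel fixes = cong-tuple λ i →
        eval-agrees (r i) rel λ p → fixes (∈-concat⁺′ p (∈-tabulate⁺ i))
        where
        open EquivariantInjection (tupleᴴ αs)
        open Injection injection using () renaming (cong to cong-tuple)
      eval-agrees (abs {ν} ν∈𝒜 {α} a r) {ς′} {ς} rel fixes
        rewrite Fixes-at {a = a} fixes (here refl) = cong-abs (∈ᵃ⇒≐ᵃ ν ⟦ α ⟧
          (inj₁ (refl , eval-agrees r {ς′} {ς} rel (fixes ∘ there))))
        where
        open EquivariantInjection (absᴴ ν ν∈𝒜 α)
        open Injection injection using () renaming (cong to cong-abs)

      ⊨-agrees : ∀ φ {ς′ ς} → Related ς′ ς → Fixes (atomsᶠ constAtoms φ) →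
                 _⊨_ S interpretation ς′ φ ⇔ _⊨_ S H ς φ
      ⊨-agrees ⊥′ rel fixes = mk⇔ id id
      ⊨-agrees (φ ⇒′ ψ) rel fixes
        with ⊨-agrees φ rel (fixes ∘ ∈-++⁺ˡ)
           | ⊨-agrees ψ rel (fixes ∘ ∈-++⁺ʳ (atomsᶠ constAtoms φ))
      ... | ihφ | ihψ = mk⇔
        [ (λ p → inj₁ (p ∘ Equivalence.from ihφ)) , inj₂ ∘ Equivalence.to ihψ ]′
        [ (λ p → inj₁ (p ∘ Equivalence.to ihφ)) , inj₂ ∘ Equivalence.from ihψ ]′
      ⊨-agrees (∀′ X φ) {ς′} {ς} rel fixes = mk⇔
        (λ h x  → Equivalence.to   (updated (pull x) x (⟦⟧.≈-refl (unkSort X))) (h (pull x)))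
        (λ h x′ → Equivalence.from (updated x′ (push x′) (⟦⟧.≈-refl (unkSort X))) (h (push x′)))
        where
        pull : Lower S H (unkSort X) → Lower S interpretation (unkSort X)
        pull (x , x<) = x , ι⁻¹-lower⁺ ι-gt (⟦⟧.supp (unkSort X) x) x<

        push : Lower S interpretation (unkSort X) → Lower S H (unkSort X)
        push (x , x<) = x , ι⁻¹-lower⁻ ι-gt (⟦⟧.supp (unkSort X) x) x<

        updated : ∀ x′ x → ⟦⟧._≈_ (unkSort X) (proj₁ x′) (proj₁ x) →
                  _⊨_ S interpretation (_[_:=_] S interpretation ς′ X x′) φ ⇔
                  _⊨_ S H (_[_:=_] S H ς X x) φ
        updated x′ x p = ⊨-agrees φ (Related-update X x′ x p rel) fixes
      ⊨-agrees (pred P r) rel fixes = mk⇔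
        (resp (eval-agrees r rel fixes)) (resp (⟦⟧.≈-sym (propSort P) (eval-agrees r rel fixes)))
        where
        open EquivariantSubset (predᴴ P)

-- Finite and medium support

module _ (em : ExcludedMiddle 0ℓ) (M : MediumSet) {s ℓ : Level} (S : Signature s) where
  open Classical em
  open MediumSet M
  open Signature S

  finite⇒medium : ∀ (H : Interpretation S ℓ) → FiniteSupport S H → MediumSupport S H 𝔸^≪
  finite⇒medium H fin α x = finite⇒⊆∙ (fin α x) (infinite⇒abundant infinite)

  -- An interpretation with finite support that agrees with H on φ.
  module FiniteModel (H : Interpretation S ℓ) (medium : MediumSupport S H 𝔸^≪)
                     (φ : Proposition S) where
    open Interpretation H

    -- A list of the atoms of supp x outside 𝔸^≪, possibly with others.
    exceptional : ∀ α → ⟦⟧.Carrier α → List Atom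
    exceptional α x = let π = proj₁ (medium α x) in map (π $ᵃ_) (atomsᵖ π)

    supp-cover : ∀ α x {a} → a ∈ₚ ⟦⟧.supp α x → a ∈ₚ 𝔸^≪ ⊎ a ∈ exceptional α x
    supp-cover α x a∈x = let π , sub = medium α x in perm-image π {𝔸^≪} (sub a∈x)

    constAtoms : Const → List Atom
    constAtoms C = exceptional (base (constSort C)) (constᴴ C)

    N : List Atom
    N = atomsᶠ constAtoms φ

    open AvoidingInjection N {𝔸^< ∖ 𝔸^≪} proj₁ (infinite⇒abundant co-infinite)
    open Renaming ι ι-inj using (ιᵃ; ιᵃ-inj)
    open Pullback em ι ι-inj hiding (interpretation)

    ι-medium⇒N : ∀ {a} → ιᵃ a ∈ₚ 𝔸^≪ → a ∈ N
    ι-medium⇒N {i , gt n} p with 𝔸^≪⊆𝔸^< p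
    ... | ()
    ι-medium⇒N {i , lt n} p = [ id , (λ q → ⊥-elim (proj₂ q p)) ]′ (ι-image n)

    N-fixed : Fixes N
    N-fixed {i , a} p = cong (i ,_) (ι-fix a p)

    pullback-finite : ∀ α x → Finite (ι⁻¹ (⟦⟧.supp α x))
    pullback-finite α x with ι⁻¹-finite (exceptional α x)
    ... | K , sub = N ++ K , λ ιa∈x →
          [ ∈-++⁺ˡ ∘ ι-medium⇒N , ∈-++⁺ʳ N ∘ sub ]′ (supp-cover α x ιa∈x)

    module _ (C : Const) where
      private
        τ : Sort 𝒜 ℬ
        τ = base (constSort C)

        c : ⟦⟧.Carrier τ
        c = constᴴ C

        K : List Atom
        K = proj₁ (pullback-finite τ c)

      -- If supp (π · c) is contained in Allowed, then ι⁻¹ (supp (π · c)) is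
      -- contained in pmss C.
      Allowed : AtomSet
      Allowed d = ∀ a → ιᵃ a ≡ d → a ∈ₚ pmss C

      allowed-cover : ∀ {d} → d ∈ₚ ⟦⟧.supp τ c → d ∈ₚ Allowed ⊎ d ∈ map ιᵃ K
      allowed-cover {d} d∈c with em {∃ λ a → ιᵃ a ≡ d}
      ... | no ¬a          = inj₁ λ a eq → ⊥-elim (¬a (a , eq))
      ... | yes (a , refl) = inj₂ (∈-map⁺ ιᵃ (proj₂ (pullback-finite τ c) {a} d∈c))

      -- An atom a of 𝔸^≪ outside N is not in the image of ι, so it is allowed.  If
      -- a is in supp c, then it is in pmss C, so ι a is allowed; and ι a is not in
      -- supp c once a is outside the finite set ι⁻¹ (supp c).
      allowed-abundant : Abundant (Allowed ∖ ⟦⟧.supp τ c)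
      allowed-abundant i L = choose
        (infinite⇒abundant infinite i (N ++ K ++ L ++ proj₁ (ι⁻¹-finite L)))
        where
        choose : (∃ λ a → (i , a) ∈ₚ 𝔸^≪ × (i , a) ∉ N ++ K ++ L ++ proj₁ (ι⁻¹-finite L)) →
                 ∃ λ a → (i , a) ∈ₚ (Allowed ∖ ⟦⟧.supp τ c) × (i , a) ∉ L
        choose (a , a∈≪ , a∉) with em {(i , a) ∈ₚ ⟦⟧.supp τ c}
        ... | no a∉c = a , (allowed , a∉c) , a∉ ∘ ∈-++⁺ʳ N ∘ ∈-++⁺ʳ K ∘ ∈-++⁺ˡ
          where
          allowed : (i , a) ∈ₚ Allowed
          allowed b refl = ⊥-elim (a∉ (∈-++⁺ˡ (subst (_∈ N) (sym (N-fixed b∈N)) b∈N)))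
            where
            b∈N : b ∈ N
            b∈N = ι-medium⇒N a∈≪
        ... | yes a∈c = ι a , (allowed , ιa∉c) , ιa∉L
          where
          allowed : (i , ι a) ∈ₚ Allowed
          allowed b eq = subst (_∈ₚ pmss C) (sym (ιᵃ-inj {b} {i , a} eq)) (constᴴ-supp C a∈c)

          ιa∉c : (i , ι a) ∉ₚ ⟦⟧.supp τ c
          ιa∉c p = a∉ (∈-++⁺ʳ N (∈-++⁺ˡ (proj₂ (pullback-finite τ c) p)))

          ιa∉L : (i , ι a) ∉ L
          ιa∉L p = a∉ (∈-++⁺ʳ N (∈-++⁺ʳ K (∈-++⁺ʳ L (proj₂ (ι⁻¹-finite L) p))))

      -- The element constᴴ C itself can be kept when ι fixes constAtoms C: an atom
      -- ι a of its support is then equal to a, whether ι a is in 𝔸^≪ or not.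
      const-with-support : ∃ λ c′ → (∀ {a} → a ∈ₚ ι⁻¹ (⟦⟧.supp τ c′) → a ∈ₚ pmss C)
                                   × (Fixes (constAtoms C) → c′ ≡ c)
      const-with-support with em {∀ {a} → a ∈ₚ ι⁻¹ (⟦⟧.supp τ c) → a ∈ₚ pmss C}
      ... | yes sub = c , sub , λ _ → refl
      ... | no ¬sub with move-into (map ιᵃ K) allowed-cover allowed-abundant
      ...   | π , into = ⟦⟧._·_ τ π c , moved , λ fixes → ⊥-elim (¬sub (kept fixes))
        where
        moved : ∀ {a} → ιᵃ a ∈ₚ ⟦⟧.supp τ (⟦⟧._·_ τ π c) → a ∈ₚ pmss C
        moved {i , a} p = into (⟦⟧.supp-· τ π c (i , reverse π $ ι a)
            (subst (λ d → (i , d) ∈ₚ ⟦⟧.supp τ (⟦⟧._·_ τ π c)) (sym ($-revʳ π (ι a))) p))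
          (i , a) (cong (i ,_) (sym ($-revʳ π (ι a))))

        kept : Fixes (constAtoms C) → ∀ {a} → ιᵃ a ∈ₚ ⟦⟧.supp τ c → a ∈ₚ pmss C
        kept fixes {a} p = constᴴ-supp C (subst (_∈ₚ ⟦⟧.supp τ c) ιa≡a p)
          where
          ιa≡a : ιᵃ a ≡ a
          ιa≡a with supp-cover τ c p
          ... | inj₁ q = N-fixed (ι-medium⇒N q)
          ... | inj₂ q = ιᵃ-inj (fixes q)

    finiteModel : Interpretation S ℓ
    finiteModel = Pullback.interpretation em ι ι-inj H pullback-finite
           (proj₁ ∘ const-with-support) (proj₁ ∘ proj₂ ∘ const-with-support)

    valid : ⊨fin S ℓ φ → ∀ ς → _⊨_ S H ς φ
    valid fin ς = Equivalence.to
      (⊨-agrees H pullback-finite _ _ (λ _ → refl) constAtoms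
        (proj₂ ∘ proj₂ ∘ const-with-support)
        φ {ς′} {ς} (λ X → ⟦⟧.≈-refl (unkSort X)) N-fixed)
      (fin finiteModel pullback-finite ς′)
      where
      ς′ : Valuation S finiteModel
      ς′ X = let x , x< = ς X in
        x , ι⁻¹-lower⁺ (λ _ → refl) (⟦⟧.supp (unkSort X) x) x<

theorem7p15 : ∀ {s ℓ} → ExcludedMiddle (s ⊔ ℓ) →
    (M : MediumSet) (S : Signature s) (φ : Proposition S) →
    ⊨fin S ℓ φ ⇔ ⊨med S ℓ (MediumSet.𝔸^≪ M) φ
theorem7p15 {s} {ℓ} em M S φ = mk⇔
  (λ fin H medium → FiniteModel.valid em₀ M S H medium φ fin)
  (λ med H finite → med H (finite⇒medium em₀ M S H finite))
  where
  em₀ : ExcludedMiddle 0ℓ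
  em₀ = lowerEM (s ⊔ ℓ) em
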